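{- For every $n\ge 1$, the upper-diagonal CNMs of size $n$ are in bijection with the permutations in $S_{n-1}$; in particular there are exactly $(n-1)!$ upper-diagonal CNMs of size $n$.
   Context: A complete non-ambiguous matrix (CNM) of size $n$ is an $n\times n$ matrix $M=(m_{i,j})$ with entries in $\{0,1\}$ whose support $T=\{(i,j): m_{i,j}=1\}$ (whose elements are called vertices) satisfies: (1) $(1,1)\in T$; (2) for every $p=(i,j)\in T$ with $p\neq(1,1)$, exactly one of the following holds: there is $(i',j)\in T$ with $i'<i$, or there is $(i,j')\in T$ with $j'<j$; (3) every row and every column of $M$ contains at least one vertex; (4) define the parent of $p=(i,j)\neq(1,1)$ to be $(i',j)$ with $i'<i$ maximal if such a vertex exists, and otherwise $(i,j')$ with $j'<j$ maximal; then every vertex is the parent of either zero or exactly two vertices. A vertex with no children is a leaf. A CNM of size $n$ is upper-diagonal if its leaves are exactly the positions $(i,n+1-i)$, $1\le i\le n$ (i.e. its leaf matrix is the anti-diagonal permutation matrix). -}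

module Defs where

open import Data.Bool.Base using (Bool; true)
open import Data.Fin.Base using (Fin; zero; opposite; _<_; _≤_)
import Data.Fin.Permutation as Perm
open import Data.Nat.Base using (ℕ; suc; NonZero)
open import Data.Product.Base using (Σ; ∃; ∃₂; _×_; _,_; proj₁)
open import Data.Sum.Base using (_⊎_)
open import Data.Vec.Base using (Vec; lookup)
open import Function.Bundles using (_⇔_)
open import Level using (0ℓ)
open import Relation.Binary.Bundles using (Setoid)
import Relation.Binary.Construct.On as On
open import Relation.Binary.PropositionalEquality
  using (_≡_; _≢_; refl; sym; trans; setoid)
open import Relation.Nullary.Negation using (¬_)

Matrix : ℕ → Set
Matrix n = Vec (Vec Bool n) n

-- Row first, then column; indices start at 0.
Position : ℕ → Set
Position n = Fin n × Fin n

-- The position (1,1), available in sizes n ≥ 1.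
root : ∀ {n} .{{_ : NonZero n}} → Position n
root {suc _} = zero , zero

module _ {n : ℕ} .{{_ : NonZero n}} (M : Matrix n) where

  Vertex : Position n → Set
  Vertex (i , j) = lookup (lookup M i) j ≡ true

  HasAbove : Position n → Set
  HasAbove (i , j) = ∃ λ i′ → i′ < i × Vertex (i′ , j)

  HasLeft : Position n → Set
  HasLeft (i , j) = ∃ λ j′ → j′ < j × Vertex (i , j′)

  NearestAbove : Position n → Position n → Set
  NearestAbove (i′ , j′) (i , j) =
    j′ ≡ j × i′ < i × Vertex (i′ , j) ×
    (∀ k → k < i → Vertex (k , j) → k ≤ i′)

  NearestLeft : Position n → Position n → Set
  NearestLeft (i′ , j′) (i , j) =
    i′ ≡ i × j′ < j × Vertex (i , j′) ×
    (∀ k → k < j → Vertex (i , k) → k ≤ j′)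

  -- Parent q p: the vertex q is the parent of the vertex p.
  Parent : Position n → Position n → Set
  Parent q p =
    Vertex p × p ≢ root ×
    (NearestAbove q p ⊎ (¬ HasAbove p × NearestLeft q p))

  NoChildren : Position n → Set
  NoChildren q = ∀ p → ¬ Parent q p

  TwoChildren : Position n → Set
  TwoChildren q = ∃₂ λ p₁ p₂ →
    p₁ ≢ p₂ × Parent q p₁ × Parent q p₂ ×
    (∀ p → Parent q p → p ≡ p₁ ⊎ p ≡ p₂)

  record IsCNM : Set where
    field
      root-vertex : Vertex root
      above-xor-left : ∀ p → Vertex p → p ≢ root →
        (HasAbove p × ¬ HasLeft p) ⊎ (¬ HasAbove p × HasLeft p)
      row-nonempty : ∀ i → ∃ λ j → Vertex (i , j)
      column-nonempty : ∀ j → ∃ λ i → Vertex (i , j)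
      complete : ∀ q → Vertex q → NoChildren q ⊎ TwoChildren q

  Leaf : Position n → Set
  Leaf p = Vertex p × NoChildren p

  -- With indices from 0, the position (i , n + 1 - i) of an n × n matrix
  -- becomes (i , opposite i).
  IsUpperDiagonal : Set
  IsUpperDiagonal = ∀ i j → Leaf (i , j) ⇔ j ≡ opposite i

-- Two upper-diagonal CNMs are equal when their matrices are, whatever the
-- proofs they carry.
UpperDiagonalCNM : (n : ℕ) .{{_ : NonZero n}} → Setoid 0ℓ 0ℓ
UpperDiagonalCNM n =
  On.setoid {B = Σ (Matrix n) λ M → IsCNM M × IsUpperDiagonal M}
    (setoid (Matrix n)) proj₁

Permutations : ℕ → Setoid 0ℓ 0ℓ
Permutations n = record
  { Carrier       = Perm.Permutation′ n
  ; _≈_           = Perm._≈_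
  ; isEquivalence = record
    { refl  = λ _ → refl
    ; sym   = λ π≈ρ i → sym (π≈ρ i)
    ; trans = λ π≈ρ ρ≈σ i → trans (π≈ρ i) (ρ≈σ i)
    }
  }

{-# OPTIONS --safe #-}

-- Read the columns from right to left, so that the leaves become the diagonal
-- cells (x , x) and all vertices lie at (x , z) with x ≤ z.  In every column z
-- but the leftmost one the topmost vertex has a nearest vertex on its left, in
-- a column e z > z.  Thus e makes the columns a tree that increases towards its
-- root, the leftmost column.  The topmost vertex of column z lies in row μ z,
-- the least descendant of z, and the vertices are exactly the diagonal cells
-- and the cells (μ v , e v), so e determines the matrix.  Conversely every such
-- tree arises.  The choices of e v among the columns beyond v are independent.
module Submission where

open import Defs
open import Data.Bool.Base using (Bool; true)
open import Data.Bool.Properties using (⇔→≡) renaming (_≟_ to _≟ᵇ_)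
open import Data.Fin.Base
  using (Fin; zero; suc; toℕ; fromℕ; inject₁; opposite; punchIn; _<_; _>_; _≤_)
open import Data.Fin.Induction using (<-wellFounded; >-wellFounded)
import Data.Fin.Permutation as Perm
open import Data.Fin.Permutation
  using (Permutation′; _⟨$⟩ʳ_; insert; remove; remove-insert; punchIn-permute)
open import Data.Fin.Properties
  using (_≟_; _<?_; any?; *↔×; <-cmp; <⇒≢; ≤∧≢⇒<; ≤-antisym; ≤fromℕ; fromℕ≢inject₁;
         inject₁-injective; opposite-involutive; opposite-prop; punchIn-injective;
         suc-injective; toℕ<n)
open import Data.Fin.Relation.Unary.Top using (view; ‵fromℕ; ‵inject₁)
open import Data.Nat.Base as ℕ using (ℕ; zero; suc; z≤n; s≤s; NonZero; _∸_; _!)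
import Data.Nat.Properties as ℕ
open import Data.Product.Base using (∃; _×_; _,_; proj₁; proj₂)
open import Data.Product.Function.NonDependent.Propositional using (_×-↔_)
open import Data.Sum.Base as Sum using (_⊎_; inj₁; inj₂)
open import Data.Vec.Base using (Vec; lookup; tabulate)
open import Data.Vec.Properties using (lookup∘tabulate; tabulate∘lookup; tabulate-cong)
open import Function.Base using (_∘_)
open import Function.Bundles using (Equivalence; Inverse; _↔_; _⇔_; mk⇔)
import Function.Construct.Composition as Compose
import Function.Construct.Symmetry as Symmetry
open import Function.Properties.Bijection using (Bijection⇒Inverse)
open import Function.Properties.Inverse using (↔-refl; ↔-sym; ↔-trans)
open import Induction.WellFounded using (WellFounded; Acc; acc)
open import Level using (0ℓ)
open import Relation.Binary.Bundles using (Setoid)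
open import Relation.Binary.Core using (Rel)
open import Relation.Binary.Definitions using (tri<; tri≈; tri>) renaming (Decidable to Decidable₂)
open import Relation.Binary.PropositionalEquality
  using (_≡_; _≢_; refl; sym; trans; cong; cong₂; subst; subst₂; setoid; module ≡-Reasoning)
open import Relation.Nullary.Decidable using (Dec; yes; no; does; dec-true; map′; _×-dec_; _⊎-dec_)
open import Relation.Nullary.Negation using (¬_; contradiction)
open import Relation.Unary using (Decidable)

open Equivalence using (to; from)

private
  variable
    m n : ℕ

-- Least and greatest elements of decidable predicates.

abstract
  -- Kept abstract because later proofs rely on the minimality alone, not on how the search
  -- computes.
  minimal : {_⊏_ : Rel (Fin n) 0ℓ} → WellFounded _⊏_ → Decidable₂ _⊏_ →
            {P : Fin n → Set} → Decidable P →
            ∃ P → ∃ λ k → P k × (∀ l → l ⊏ k → ¬ P l)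
  minimal {_⊏_ = _⊏_} wf _⊏?_ {P} P? (k , Pk) = descend k (wf k) Pk
    where
    descend : ∀ k → Acc _⊏_ k → P k → ∃ λ k → P k × (∀ l → l ⊏ k → ¬ P l)
    descend k (acc rs) Pk with any? (λ l → (l ⊏? k) ×-dec P? l)
    ... | yes (l , l⊏k , Pl) = descend l (rs l⊏k) Pl
    ... | no ∄l = k , Pk , λ l l⊏k Pl → ∄l (l , l⊏k , Pl)

least : {P : Fin n → Set} → Decidable P →
        ∃ P → ∃ λ k → P k × (∀ l → l < k → ¬ P l)
least = minimal <-wellFounded _<?_

greatest : {P : Fin n → Set} → Decidable P →
           ∃ P → ∃ λ k → P k × (∀ l → l > k → ¬ P l)
greatest = minimal >-wellFounded (λ i j → j <? i)

-- Increasing trees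

Increasing : (Fin m → Fin (suc m)) → Set
Increasing e = ∀ v → inject₁ v < e v

-- μ sends each node to its least descendant in the tree with parent map e.
record IsLowest (e : Fin m → Fin (suc m)) (μ : Fin (suc m) → Fin (suc m)) : Set where
  field
    lowest-≤        : ∀ z → μ z ≤ z
    lowest-parent   : ∀ v → μ (e v) ≤ μ (inject₁ v)
    lowest-attained : ∀ z → μ z ≡ z ⊎ ∃ λ v → e v ≡ z × μ (inject₁ v) ≡ μ z

TreeCell : (Fin m → Fin (suc m)) → (Fin (suc m) → Fin (suc m)) → Fin (suc m) → Fin (suc m) → Set
TreeCell e μ x z = x ≡ z ⊎ ∃ λ v → μ (inject₁ v) ≡ x × e v ≡ z

module Tree {e : Fin m → Fin (suc m)} {μ : Fin (suc m) → Fin (suc m)}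
            (increasing : Increasing e) (isLowest : IsLowest e μ) where
  open IsLowest isLowest

  child-< : ∀ {v z} → e v ≡ z → inject₁ v < z
  child-< refl = increasing _

  lowest-cell : ∀ z → TreeCell e μ (μ z) z
  lowest-cell z with lowest-attained z
  ... | inj₁ μz≡z = inj₁ μz≡z
  ... | inj₂ (v , ev≡z , μv≡μz) = inj₂ (v , μv≡μz , ev≡z)

  -- Passing to the child that attains the minimum keeps `μ` and lowers the node, so the descent
  -- ends at a node that is its own least descendant.
  lowest-idempotent : ∀ z → μ (μ z) ≡ μ z
  lowest-idempotent z = go z (<-wellFounded z)
    where
    go : ∀ z → Acc _<_ z → μ (μ z) ≡ μ z
    go z (acc rs) with lowest-attained z
    ... | inj₁ μz≡z = cong μ μz≡z
    ... | inj₂ (v , ev≡z , μv≡μz) =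
      subst (λ x → μ x ≡ x) μv≡μz (go (inject₁ v) (rs (child-< ev≡z)))

  -- The nodes with a given least descendant form a chain under e.
  chain : ∀ z v → inject₁ v < z → μ (inject₁ v) ≡ μ z → e v ≤ z × μ (e v) ≡ μ z
  chain z = go z (<-wellFounded z)
    where
    go : ∀ z → Acc _<_ z → ∀ v → inject₁ v < z → μ (inject₁ v) ≡ μ z → e v ≤ z × μ (e v) ≡ μ z
    go z (acc rs) v v<z μv≡μz with lowest-attained z
    ... | inj₁ μz≡z = contradiction v<z
            (ℕ.≤⇒≯ (subst (_≤ inject₁ v) (trans μv≡μz μz≡z) (lowest-≤ _)))
    ... | inj₂ (w , refl , μw≡μz) with <-cmp (inject₁ v) (inject₁ w)
    ...   | tri< v<w _ _ =
            let ev≤w , μev≡μw = go (inject₁ w) (rs (increasing w)) v v<w (trans μv≡μz (sym μw≡μz))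
            in ℕ.≤-trans ev≤w (ℕ.<⇒≤ (increasing w)) , trans μev≡μw μw≡μz
    ...   | tri≈ _ v≡w _ with refl ← inject₁-injective v≡w = ℕ.≤-refl , refl
    -- The induction hypothesis at `v`, applied to `w`, would give `e w ≤ v`, but `e w` is `z`.
    ...   | tri> _ _ w<v = contradiction v<z
            (ℕ.≤⇒≯ (proj₁ (go (inject₁ v) (rs v<z) w w<v (trans μw≡μz (sym μv≡μz)))))

  treeCell-≤ : ∀ {x z} → TreeCell e μ x z → x ≤ z
  treeCell-≤ (inj₁ refl) = ℕ.≤-refl
  treeCell-≤ (inj₂ (v , refl , refl)) = ℕ.≤-trans (lowest-≤ _) (ℕ.<⇒≤ (increasing v))

  -- With `lowest-cell` this makes `μ z` the row of the topmost cell of column `z`.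
  lowest-least : ∀ {x z} → TreeCell e μ x z → μ z ≤ x
  lowest-least (inj₁ refl) = lowest-≤ _
  lowest-least (inj₂ (v , refl , refl)) = lowest-parent v

  -- Climbing from node `zero` to the root never raises `μ`, by `lowest-parent`.
  lowest-root : μ (fromℕ m) ≡ zero
  lowest-root = ≤-antisym (ℕ.≤-trans (go zero (>-wellFounded zero)) (lowest-≤ zero)) z≤n
    where
    go : ∀ z → Acc _>_ z → μ (fromℕ m) ≤ μ z
    go z (acc rs) with view z
    ... | ‵fromℕ = ℕ.≤-refl
    ... | ‵inject₁ v = ℕ.≤-trans (go (e v) (rs (increasing v))) (lowest-parent v)

  -- A cell of this row beyond `v` comes from a node `w` of the chain of `v`. By `chain`, `w < v`
  -- would give `e w ≤ v`, while `v < w` gives `e v ≤ w < e w`. This is how `e` is recovered from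
  -- the cells.
  parent-nearest : ∀ v z → inject₁ v < z → TreeCell e μ (μ (inject₁ v)) z → e v ≤ z
  parent-nearest v z v<z (inj₁ refl) = contradiction v<z (ℕ.≤⇒≯ (lowest-≤ _))
  parent-nearest v z v<z (inj₂ (w , μw≡μv , refl)) with <-cmp (inject₁ v) (inject₁ w)
  ... | tri< v<w _ _ = ℕ.≤-trans (proj₁ (chain _ v v<w (sym μw≡μv))) (ℕ.<⇒≤ (increasing w))
  ... | tri≈ _ v≡w _ with refl ← inject₁-injective v≡w = ℕ.≤-refl
  ... | tri> _ _ w<v = contradiction v<z (ℕ.≤⇒≯ (proj₁ (chain _ w w<v μw≡μv)))

  -- Along a chain `μ` stays constant, so if row `x` continues beyond `z`, then `z` itself has least
  -- descendant `x`. Hence no cell has vertices both above and on its left.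
  cell-before⇒lowest : ∀ {x z z′} → z < z′ → TreeCell e μ x z′ → TreeCell e μ x z → x ≡ μ z
  cell-before⇒lowest z<z′ (inj₁ refl) cell = contradiction z<z′ (ℕ.≤⇒≯ (treeCell-≤ cell))
  cell-before⇒lowest z<z′ (inj₂ (v , refl , refl)) (inj₁ refl) = sym (lowest-idempotent _)
  cell-before⇒lowest z<z′ (inj₂ (v , refl , refl)) (inj₂ (w , μw≡μv , refl))
    with <-cmp (inject₁ v) (inject₁ w)
  ... | tri< v<w _ _ = contradiction z<z′
          (ℕ.≤⇒≯ (ℕ.≤-trans (proj₁ (chain _ v v<w (sym μw≡μv))) (ℕ.<⇒≤ (increasing w))))
  ... | tri≈ _ v≡w _ with refl ← inject₁-injective v≡w = contradiction z<z′ (ℕ.<-irrefl refl)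
  ... | tri> _ _ w<v = sym (proj₂ (chain _ w w<v μw≡μv))

  lowest-right : ∀ z → z ≢ fromℕ m → ∃ λ z′ → z < z′ × TreeCell e μ (μ z) z′
  lowest-right z z≢root with view z
  ... | ‵fromℕ = contradiction refl z≢root
  ... | ‵inject₁ v = e v , increasing v , inj₂ (v , refl , refl)

-- Induction along the child through which `μ` attains its value, where `lowest-parent` bounds `μ′`.
-- Used both ways, it shows that the conditions of `IsLowest` determine the map.
lowest-antitone : {e : Fin m → Fin (suc m)} {μ μ′ : Fin (suc m) → Fin (suc m)} →
                  Increasing e → IsLowest e μ → IsLowest e μ′ → ∀ z → μ′ z ≤ μ z
lowest-antitone {e = e} {μ} {μ′} increasing L L′ z = go z (<-wellFounded z)
  where
  module L = IsLowest L
  module L′ = IsLowest L′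
  go : ∀ z → Acc _<_ z → μ′ z ≤ μ z
  go z (acc rs) with L.lowest-attained z
  ... | inj₁ μz≡z = subst (μ′ z ≤_) (sym μz≡z) (L′.lowest-≤ z)
  ... | inj₂ (v , refl , μv≡μz) = subst (μ′ z ≤_) μv≡μz
          (ℕ.≤-trans (L′.lowest-parent v) (go (inject₁ v) (rs (increasing v))))

lowest-unique : {e : Fin m → Fin (suc m)} {μ μ′ : Fin (suc m) → Fin (suc m)} →
                Increasing e → IsLowest e μ → IsLowest e μ′ → ∀ z → μ z ≡ μ′ z
lowest-unique increasing L L′ z =
  ≤-antisym (lowest-antitone increasing L′ L z) (lowest-antitone increasing L L′ z)

-- Equal cells have equal topmost rows, so the cell that `e′ v` contributes lies in the row in which
-- `e v` is the nearest column beyond `v`.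
parents-≤ : {e e′ : Fin m → Fin (suc m)} {μ μ′ : Fin (suc m) → Fin (suc m)} →
            Increasing e → IsLowest e μ → Increasing e′ → IsLowest e′ μ′ →
            (∀ x z → TreeCell e μ x z ⇔ TreeCell e′ μ′ x z) → ∀ v → e v ≤ e′ v
parents-≤ {e = e} {e′} {μ} {μ′} inc L inc′ L′ same v =
  T.parent-nearest v (e′ v) (inc′ v)
    (same _ _ .from (inj₂ (v , μ′≡μ , refl)))
  where
  module T = Tree inc L
  module T′ = Tree inc′ L′
  μ′≡μ : μ′ (inject₁ v) ≡ μ (inject₁ v)
  μ′≡μ = ≤-antisym (T′.lowest-least (same _ _ .to (T.lowest-cell _)))
                   (T.lowest-least (same _ _ .from (T′.lowest-cell _)))

-- Existence of least descendants.

data Descends (e : Fin m → Fin (suc m)) : Fin (suc m) → Fin (suc m) → Set where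
  here  : ∀ {z} → Descends e z z
  there : ∀ {v z} → Descends e (e v) z → Descends e (inject₁ v) z

descends-trans : {e : Fin m → Fin (suc m)} → ∀ {x y z} →
                 Descends e x y → Descends e y z → Descends e x z
descends-trans here q = q
descends-trans (there p) q = there (descends-trans p q)

-- Paths grow at their lower end, whereas `lowest-attained` asks for the child through which a path
-- enters `z`.
descends-last : {e : Fin m → Fin (suc m)} → ∀ {x z} → Descends e x z →
                x ≡ z ⊎ ∃ λ v → e v ≡ z × Descends e x (inject₁ v)
descends-last here = inj₁ refl
descends-last (there p) with descends-last p
... | inj₁ refl = inj₂ (_ , refl , here)
... | inj₂ (v , ev≡z , q) = inj₂ (v , ev≡z , there q)

-- The equations replace a match on `there` at the endpoints `fromℕ _` and `inject₁ v`, where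
-- unification would have to invert `inject₁`.
descends-first : {e : Fin m → Fin (suc m)} → ∀ {x z} → Descends e x z →
                 x ≡ z ⊎ ∃ λ v → inject₁ v ≡ x × Descends e (e v) z
descends-first here = inj₁ refl
descends-first (there p) = inj₂ (_ , refl , p)

module _ {e : Fin m → Fin (suc m)} (increasing : Increasing e) where

  -- The path upwards from `x` is forced, and it climbs until it meets `z` or ends at the root.
  descends? : Decidable₂ (Descends e)
  descends? x z = go x (>-wellFounded x)
    where
    go : ∀ x → Acc _>_ x → Dec (Descends e x z)
    go x (acc rs) with x ≟ z
    ... | yes refl = yes here
    ... | no x≢z with view x
    ...   | ‵fromℕ = no λ p → case-root (descends-first p)
      where
      case-root : ¬ (fromℕ _ ≡ z ⊎ ∃ λ v → inject₁ v ≡ fromℕ _ × Descends e (e v) z)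
      case-root (inj₁ x≡z) = x≢z x≡z
      case-root (inj₂ (v , v≡root , _)) = fromℕ≢inject₁ (sym v≡root)
    ...   | ‵inject₁ v = map′ there case-inner (go (e v) (rs (increasing v)))
      where
      case-inner : Descends e (inject₁ v) z → Descends e (e v) z
      case-inner p with descends-first p
      ... | inj₁ x≡z = contradiction x≡z x≢z
      ... | inj₂ (w , w≡v , q) with refl ← inject₁-injective w≡v = q

  -- The path from `μ z` enters `z` through a child that also has `μ z` as a descendant, so both
  -- have the same least one.
  lowest-exists : ∃ (IsLowest e)
  lowest-exists = μ , record
    { lowest-≤        = λ z → μ-least here
    ; lowest-parent   = λ v → μ-least (descends-trans (μ-descends (inject₁ v)) (there here))
    ; lowest-attained = attained
    }
    where
    lowest : ∀ z → ∃ λ x → Descends e x z × (∀ y → y < x → ¬ Descends e y z)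
    lowest z = least (λ x → descends? x z) (z , here)
    μ : Fin (suc _) → Fin (suc _)
    μ = proj₁ ∘ lowest
    μ-descends : ∀ z → Descends e (μ z) z
    μ-descends = proj₁ ∘ proj₂ ∘ lowest
    μ-least : ∀ {x z} → Descends e x z → μ z ≤ x
    μ-least {x} {z} p = ℕ.≮⇒≥ λ x<μz → proj₂ (proj₂ (lowest z)) x x<μz p
    attained : ∀ z → μ z ≡ z ⊎ ∃ λ v → e v ≡ z × μ (inject₁ v) ≡ μ z
    attained z with descends-last (μ-descends z)
    ... | inj₁ μz≡z = inj₁ μz≡z
    ... | inj₂ (v , refl , p) = inj₂ (v , refl , ≤-antisym (μ-least p)
            (μ-least (descends-trans (μ-descends (inject₁ v)) (there here))))

-- Upper-diagonal matrices as increasing trees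

-- In mirrored columns, further left means a larger `z`.
Cell : Matrix (suc m) → Fin (suc m) → Fin (suc m) → Set
Cell M x z = Vertex M (x , opposite z)

opposite-< : {i j : Fin n} → i < j → opposite j < opposite i
opposite-< {i = i} {j} i<j = subst₂ ℕ._<_ (sym (opposite-prop j)) (sym (opposite-prop i))
  (ℕ.∸-monoʳ-< (s≤s i<j) (toℕ<n j))

opposite-fromℕ : ∀ m → opposite (fromℕ m) ≡ zero
opposite-fromℕ m = opposite-involutive zero

opposite-elim : (P : Fin n → Set) → (∀ z → P (opposite z)) → ∀ j → P j
opposite-elim P all j = subst P (opposite-involutive j) (all (opposite j))

opposite-transpose : {i j : Fin n} → i ≡ opposite j → j ≡ opposite i
opposite-transpose refl = sym (opposite-involutive _)

vertex? : (M : Matrix (suc m)) → Decidable (Vertex M)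
vertex? M (i , j) = lookup (lookup M i) j ≟ᵇ true

cell? : (M : Matrix (suc m)) → ∀ x z → Dec (Cell M x z)
cell? M x z = vertex? M (x , opposite z)

-- An upper-diagonal CNM without mention of parents and children: the position of the cells relative
-- to the diagonal already fixes how many children each has. The `corner` is the root (1,1).
record IsUpperTriangular (M : Matrix (suc m)) : Set where
  field
    cell-≤   : ∀ x z → Cell M x z → x ≤ z
    diagonal : ∀ x → Cell M x x
    corner   : Cell M zero (fromℕ m)
    above-xor-left : ∀ x z → Cell M x z → ¬ (x ≡ zero × z ≡ fromℕ m) →
      (HasAbove M (x , opposite z) × ¬ HasLeft M (x , opposite z)) ⊎
      (¬ HasAbove M (x , opposite z) × HasLeft M (x , opposite z))

-- From upper-diagonal CNMs to triangular matrices.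

module _ (M : Matrix (suc m)) where

  left-cell : ∀ x z z′ → z < z′ → Cell M x z′ → HasLeft M (x , opposite z)
  left-cell x z z′ z<z′ cell = _ , opposite-< z<z′ , cell

  cell-left : ∀ x z → HasLeft M (x , opposite z) → ∃ λ z′ → z < z′ × Cell M x z′
  cell-left x z (j , j<z , vertex) =
    opposite j ,
    subst (_< opposite j) (opposite-involutive z) (opposite-< j<z) ,
    subst (λ j → Vertex M (x , j)) (sym (opposite-involutive j)) vertex

  -- Of two vertices below `q`, the nearer one separates the farther from `q`. So `q` has at most
  -- one child in its column.
  nearestAbove-unique : ∀ {q p₁ p₂} → NearestAbove M q p₁ → NearestAbove M q p₂ →
                        Vertex M p₁ → Vertex M p₂ → p₁ ≡ p₂
  nearestAbove-unique {p₁ = i₁ , _} {i₂ , _}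
    (refl , q<p₁ , _ , near₁) (refl , q<p₂ , _ , near₂) vertex₁ vertex₂ with <-cmp i₁ i₂
  ... | tri< p₁<p₂ _ _ = contradiction q<p₁ (ℕ.≤⇒≯ (near₂ _ p₁<p₂ vertex₁))
  ... | tri≈ _ refl _ = refl
  ... | tri> _ _ p₂<p₁ = contradiction q<p₂ (ℕ.≤⇒≯ (near₁ _ p₂<p₁ vertex₂))

  nearestLeft-unique : ∀ {q p₁ p₂} → NearestLeft M q p₁ → NearestLeft M q p₂ →
                       Vertex M p₁ → Vertex M p₂ → p₁ ≡ p₂
  nearestLeft-unique {p₁ = _ , j₁} {_ , j₂}
    (refl , q<p₁ , _ , near₁) (refl , q<p₂ , _ , near₂) vertex₁ vertex₂ with <-cmp j₁ j₂
  ... | tri< p₁<p₂ _ _ = contradiction q<p₁ (ℕ.≤⇒≯ (near₂ _ p₁<p₂ vertex₁))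
  ... | tri≈ _ refl _ = refl
  ... | tri> _ _ p₂<p₁ = contradiction q<p₂ (ℕ.≤⇒≯ (near₁ _ p₂<p₁ vertex₂))

  -- With nothing on the right, all children lie below, where there is at most one; completeness
  -- excludes exactly one.
  rightmost-noChildren : ∀ {i j} → NoChildren M (i , j) ⊎ TwoChildren M (i , j) →
                         (∀ k → j < k → ¬ Vertex M (i , k)) → NoChildren M (i , j)
  rightmost-noChildren (inj₁ none) _ = none
  rightmost-noChildren {i} {j} (inj₂ (p₁ , p₂ , p₁≢p₂ , parent₁ , parent₂ , _)) rightmost =
    contradiction (nearestAbove-unique (above parent₁) (above parent₂) (proj₁ parent₁) (proj₁ parent₂))
                  p₁≢p₂
    where
    above : ∀ {p} → Parent M (i , j) p → NearestAbove M (i , j) p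
    above (_ , _ , inj₁ nearest) = nearest
    above (vertex , _ , inj₂ (_ , refl , j<k , _)) = contradiction vertex (rightmost _ j<k)

  -- The last vertex of a row is a leaf, hence on the anti-diagonal, and bounds all others of the
  -- row.
  upperDiagonal⇒triangular : IsCNM M → IsUpperDiagonal M → IsUpperTriangular M
  upperDiagonal⇒triangular cnm diag = record
    { cell-≤   = λ x z cell → ℕ.≮⇒≥ λ z<x →
        ℕ.<⇒≱ (opposite-< z<x) (beforeLeaf x (opposite z) (>-wellFounded _) cell)
    ; diagonal = λ x → proj₁ (diag x (opposite x) .from refl)
    ; corner   = subst (λ j → Vertex M (zero , j)) (sym (opposite-fromℕ _)) root-vertex
    ; above-xor-left = λ x z cell notCorner → above-xor-left (x , opposite z) cell
        λ isRoot → notCorner (cong proj₁ isRoot ,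
          opposite-transpose (sym (cong proj₂ isRoot)))
    }
    where
    open IsCNM cnm
    beforeLeaf : ∀ i j → Acc _>_ j → Vertex M (i , j) → j ≤ opposite i
    beforeLeaf i j (acc rs) vertex with any? (λ k → (j <? k) ×-dec vertex? M (i , k))
    ... | yes (k , j<k , vertex′) = ℕ.≤-trans (ℕ.<⇒≤ j<k) (beforeLeaf i k (rs j<k) vertex′)
    ... | no rightmost = ℕ.≤-reflexive (cong toℕ (diag i j .to
            (vertex , rightmost-noChildren (complete (i , j) vertex)
              λ k j<k vertex′ → rightmost (k , j<k , vertex′))))

-- From triangular matrices back to upper-diagonal CNMs.

module _ {M : Matrix (suc m)} (triangular : IsUpperTriangular M) where
  open IsUpperTriangular triangular

  -- A child would lie beyond the diagonal, against `cell-≤`.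
  diagonal-noChildren : ∀ x → NoChildren M (x , opposite x)
  diagonal-noChildren x (x′ , _) (vertex , _ , inj₁ (refl , x<x′ , _)) =
    ℕ.<⇒≱ x<x′ (cell-≤ x′ x vertex)
  diagonal-noChildren x (_ , j) (vertex , _ , inj₂ (_ , refl , x<j , _)) =
    ℕ.<⇒≱ (subst (opposite j <_) (opposite-involutive x) (opposite-< x<j))
      (cell-≤ x (opposite j) (subst (λ j → Vertex M (x , j)) (sym (opposite-involutive j)) vertex))

  -- The diagonal cells `(z , z)` below and `(x , x)` on the right guarantee a nearest vertex in
  -- each direction.
  inner-twoChildren : ∀ x z → Cell M x z → x < z → TwoChildren M (x , opposite z)
  inner-twoChildren x z cell x<z
    with least (λ k → (x <? k) ×-dec cell? M k z) (z , x<z , diagonal z)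
       | least (λ j → (opposite z <? j) ×-dec vertex? M (x , j)) (opposite x , opposite-< x<z , diagonal x)
  ... | k , (x<k , below) , k-least | j , (z<j , right) , j-least =
    (k , opposite z) , (x , j) , (λ same → <⇒≢ x<k (sym (cong proj₁ same))) ,
    parent-below , parent-right , only
    where
    parent-below : Parent M (x , opposite z) (k , opposite z)
    parent-below = below , (λ isRoot → contradiction (subst (x <_) (cong proj₁ isRoot) x<k) λ ()) ,
      inj₁ (refl , x<k , cell , λ l l<k vertex → ℕ.≮⇒≥ λ x<l → k-least l l<k (x<l , vertex))
    -- `Parent` prefers a vertex above. The vertex at `j` has one on its left, so the exclusive or
    -- rules out any above it.
    notAbove : ¬ HasAbove M (x , j)
    notAbove with above-xor-left x (opposite j)
                    (subst (λ j → Vertex M (x , j)) (sym (opposite-involutive j)) right)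
                    (λ { (_ , isCorner) → contradiction
                      (subst (opposite z <_) (trans (opposite-transpose (sym isCorner)) (opposite-fromℕ _)) z<j) λ () })
    ... | inj₁ (_ , notLeft) = contradiction
            (subst (λ j → HasLeft M (x , j)) (sym (opposite-involutive j)) (opposite z , z<j , cell)) notLeft
    ... | inj₂ (notAbove′ , _) = notAbove′ ∘ subst (λ j → HasAbove M (x , j)) (sym (opposite-involutive j))
    parent-right : Parent M (x , opposite z) (x , j)
    parent-right = right , (λ isRoot → contradiction (subst (opposite z <_) (cong proj₂ isRoot) z<j) λ ()) ,
      inj₂ (notAbove , refl , z<j , cell , λ l l<j vertex → ℕ.≮⇒≥ λ z<l → j-least l l<j (z<l , vertex))
    only : ∀ p → Parent M (x , opposite z) p → p ≡ (k , opposite z) ⊎ p ≡ (x , j)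
    only p (vertex , _ , inj₁ nearest) with parent-below
    ... | _ , _ , inj₁ nearest′ = inj₁ (nearestAbove-unique M nearest nearest′ vertex below)
    ... | _ , _ , inj₂ (_ , _ , z<z , _) = contradiction z<z (ℕ.<-irrefl refl)
    only p (vertex , _ , inj₂ (_ , nearest)) with parent-right
    ... | _ , _ , inj₁ (_ , x<x , _) = contradiction x<x (ℕ.<-irrefl refl)
    ... | _ , _ , inj₂ (_ , nearest′) = inj₂ (nearestLeft-unique M nearest nearest′ vertex right)

  triangular⇒cnm : IsCNM M
  triangular⇒cnm = record
    { root-vertex     = subst (λ j → Vertex M (zero , j)) (opposite-fromℕ _) corner
    ; above-xor-left  = λ (i , j) → opposite-elim
        (λ j → Vertex M (i , j) → (i , j) ≢ root →
          (HasAbove M (i , j) × ¬ HasLeft M (i , j)) ⊎ (¬ HasAbove M (i , j) × HasLeft M (i , j)))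
        (λ z cell notRoot → above-xor-left i z cell λ { (refl , refl) →
          notRoot (cong (zero ,_) (opposite-fromℕ _)) }) j
    ; row-nonempty    = λ x → opposite x , diagonal x
    ; column-nonempty = opposite-elim (λ j → ∃ λ i → Vertex M (i , j)) λ z → z , diagonal z
    ; complete        = λ (i , j) → opposite-elim
        (λ j → Vertex M (i , j) → NoChildren M (i , j) ⊎ TwoChildren M (i , j))
        (λ z → complete i z) j
    }
    where
    complete : ∀ x z → Cell M x z → NoChildren M (x , opposite z) ⊎ TwoChildren M (x , opposite z)
    complete x z cell with x ≟ z
    ... | yes refl = inj₁ (diagonal-noChildren x)
    ... | no x≢z = inj₂ (inner-twoChildren x z cell (≤∧≢⇒< (cell-≤ x z cell) x≢z))

  triangular⇒upperDiagonal : IsUpperDiagonal M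
  triangular⇒upperDiagonal i j = mk⇔
    (opposite-elim (λ j → Leaf M (i , j) → j ≡ opposite i) leaf-diagonal j)
    (λ { refl → diagonal i , diagonal-noChildren i })
    where
    leaf-diagonal : ∀ z → Leaf M (i , opposite z) → opposite z ≡ opposite i
    leaf-diagonal z (cell , noChildren) with i ≟ z
    ... | yes refl = refl
    ... | no i≢z with inner-twoChildren i z cell (≤∧≢⇒< (cell-≤ i z cell) i≢z)
    ...   | p , _ , _ , parent , _ = contradiction parent (noChildren p)

-- Matrices encoded by increasing trees.

record Encodes (M : Matrix (suc m)) (e : Fin m → Fin (suc m)) : Set where
  field
    increasing : Increasing e
    lowest     : ∃ (IsLowest e)
    cell⇔      : ∀ x z → Cell M x z ⇔ TreeCell e (proj₁ lowest) x z

encodes-cong : {M : Matrix (suc m)} {e e′ : Fin m → Fin (suc m)} →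
               (∀ v → e v ≡ e′ v) → Encodes M e → Encodes M e′
encodes-cong {e = e} {e′} e≡e′ encodes = record
  { increasing = λ v → subst (inject₁ v <_) (e≡e′ v) (increasing v)
  ; lowest     = μ , record
    { lowest-≤        = lowest-≤
    ; lowest-parent   = λ v → subst (λ z → μ z ≤ μ (inject₁ v)) (e≡e′ v) (lowest-parent v)
    ; lowest-attained = λ z → Sum.map₂ (λ (v , ev≡z , μv≡μz) → v , trans (sym (e≡e′ v)) ev≡z , μv≡μz)
                                       (lowest-attained z)
    }
  ; cell⇔      = λ x z → mk⇔
      (Sum.map₂ (λ (v , μv≡x , ev≡z) → v , μv≡x , trans (sym (e≡e′ v)) ev≡z) ∘ cell⇔ x z .to)
      (cell⇔ x z .from ∘ Sum.map₂ (λ (v , μv≡x , ev≡z) → v , μv≡x , trans (e≡e′ v) ev≡z))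
  }
  where
  open Encodes encodes
  μ = proj₁ lowest
  open IsLowest (proj₂ lowest)

-- A topmost cell has nothing above it and, away from the root, a left neighbour by `lowest-right`.
-- Any other cell has the topmost one above it and, by `cell-before⇒lowest`, nothing on its left.
encodes⇒triangular : {M : Matrix (suc m)} {e : Fin m → Fin (suc m)} →
                     Encodes M e → IsUpperTriangular M
encodes⇒triangular {m} {M} {e} encodes = record
  { cell-≤   = λ x z → treeCell-≤ ∘ cell⇔ x z .to
  ; diagonal = λ x → cell⇔ x x .from (inj₁ refl)
  ; corner   = subst (λ x → Cell M x (fromℕ m)) lowest-root (cell⇔ _ _ .from (lowest-cell (fromℕ m)))
  ; above-xor-left = xor
  }
  where
  open Encodes encodes
  μ = proj₁ lowest
  open Tree increasing (proj₂ lowest)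
  xor : ∀ x z → Cell M x z → ¬ (x ≡ zero × z ≡ fromℕ m) →
        (HasAbove M (x , opposite z) × ¬ HasLeft M (x , opposite z)) ⊎
        (¬ HasAbove M (x , opposite z) × HasLeft M (x , opposite z))
  xor x z cell notCorner with x ≟ μ z
  ... | yes refl = inj₂ (notAbove , left)
    where
    notAbove : ¬ HasAbove M (μ z , opposite z)
    notAbove (x′ , x′<μz , cell′) = ℕ.<⇒≱ x′<μz (lowest-least (cell⇔ x′ z .to cell′))
    left : HasLeft M (μ z , opposite z)
    left with lowest-right z (λ { refl → notCorner (lowest-root , refl) })
    ... | z′ , z<z′ , cell′ = left-cell M _ z z′ z<z′ (cell⇔ _ z′ .from cell′)
  ... | no x≢μz = inj₁
        ( (μ z , ≤∧≢⇒< (lowest-least (cell⇔ x z .to cell)) (x≢μz ∘ sym) , cell⇔ _ z .from (lowest-cell z))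
        , notLeft )
    where
    notLeft : ¬ HasLeft M (x , opposite z)
    notLeft left with cell-left M x z left
    ... | z′ , z<z′ , cell′ = x≢μz (cell-before⇒lowest z<z′ (cell⇔ x z′ .to cell′) (cell⇔ x z .to cell))

triangular⇒encodes : {M : Matrix (suc m)} → IsUpperTriangular M → ∃ (Encodes M)
triangular⇒encodes {m} {M} triangular = e , record
  { increasing = e-increasing
  ; lowest     = μ , record
    { lowest-≤        = λ z → μ-least z z (diagonal z)
    -- Column `e v` has a cell in row `μ (inject₁ v)`, so its topmost row is at most that.
    ; lowest-parent   = λ v → μ-least _ (e v) (e-cell v)
    ; lowest-attained = attained
    }
  ; cell⇔      = λ x z → mk⇔ (cell⇒treeCell x z) treeCell⇒cell
  }
  where
  open IsUpperTriangular triangular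

  topmost : ∀ z → ∃ λ x → Cell M x z × (∀ y → y < x → ¬ Cell M y z)
  topmost z = least (λ x → cell? M x z) (z , diagonal z)
  μ : Fin (suc m) → Fin (suc m)
  μ = proj₁ ∘ topmost
  μ-cell : ∀ z → Cell M (μ z) z
  μ-cell = proj₁ ∘ proj₂ ∘ topmost
  μ-least : ∀ x z → Cell M x z → μ z ≤ x
  μ-least x z cell = ℕ.≮⇒≥ λ x<μz → proj₂ (proj₂ (topmost z)) x x<μz cell

  left-of-topmost : ∀ v → ∃ λ z → inject₁ v < z × Cell M (μ (inject₁ v)) z
  left-of-topmost v with above-xor-left _ (inject₁ v) (μ-cell (inject₁ v)) (λ (_ , v≡root) → fromℕ≢inject₁ (sym v≡root))
  ... | inj₁ ((x , x<μv , cell) , _) = contradiction (μ-least x (inject₁ v) cell) (ℕ.<⇒≱ x<μv)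
  ... | inj₂ (_ , left) = cell-left M _ (inject₁ v) left

  nearestLeft : ∀ v → ∃ λ z → (inject₁ v < z × Cell M (μ (inject₁ v)) z) ×
                (∀ y → y < z → ¬ (inject₁ v < y × Cell M (μ (inject₁ v)) y))
  nearestLeft v = least (λ z → (inject₁ v <? z) ×-dec cell? M (μ (inject₁ v)) z) (left-of-topmost v)
  e : Fin m → Fin (suc m)
  e = proj₁ ∘ nearestLeft
  e-increasing : Increasing e
  e-increasing v = proj₁ (proj₁ (proj₂ (nearestLeft v)))
  e-cell : ∀ v → Cell M (μ (inject₁ v)) (e v)
  e-cell v = proj₂ (proj₁ (proj₂ (nearestLeft v)))
  e-least : ∀ v z → inject₁ v < z → Cell M (μ (inject₁ v)) z → e v ≤ z
  e-least v z v<z cell = ℕ.≮⇒≥ λ z<ev → proj₂ (proj₂ (nearestLeft v)) z z<ev (v<z , cell)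

  -- The next vertex of the row towards the diagonal has a vertex on its left,
  -- so it is the topmost one of its column.
  inner⇒treeCell : ∀ x z → Cell M x z → x < z → ∃ λ v → μ (inject₁ v) ≡ x × e v ≡ z
  inner⇒treeCell x z cell x<z
    with greatest (λ k → (k <? z) ×-dec cell? M x k) (x , x<z , diagonal x)
  ... | k , (k<z , cell′) , k-greatest with view k
  ...   | ‵fromℕ = contradiction (≤fromℕ z) (ℕ.<⇒≱ k<z)
  ...   | ‵inject₁ v = v , μv≡x ,
            -- Were `e v < z`, row `x` would have a cell strictly between `v` and `z`, against the
            -- choice of `k`.
            ≤-antisym ev≤z (ℕ.≮⇒≥ λ ev<z → k-greatest (e v) (e-increasing v)
              (ev<z , subst (λ x → Cell M x (e v)) μv≡x (e-cell v)))
    where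
    μv≡x : μ (inject₁ v) ≡ x
    μv≡x with μ (inject₁ v) ≟ x
    ... | yes eq = eq
    ... | no μv≢x with above-xor-left x (inject₁ v) cell′ (λ (_ , v≡root) → fromℕ≢inject₁ (sym v≡root))
    ...   | inj₁ (_ , notLeft) = contradiction (left-cell M x (inject₁ v) z k<z cell) notLeft
    ...   | inj₂ (notAbove , _) = contradiction
              (μ (inject₁ v) , ≤∧≢⇒< (μ-least x (inject₁ v) cell′) μv≢x , μ-cell (inject₁ v)) notAbove
    ev≤z : e v ≤ z
    ev≤z = e-least v z k<z (subst (λ x → Cell M x z) (sym μv≡x) cell)

  cell⇒treeCell : ∀ x z → Cell M x z → TreeCell e μ x z
  cell⇒treeCell x z cell with x ≟ z
  ... | yes x≡z = inj₁ x≡z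
  ... | no x≢z = inj₂ (inner⇒treeCell x z cell (≤∧≢⇒< (cell-≤ x z cell) x≢z))

  treeCell⇒cell : ∀ {x z} → TreeCell e μ x z → Cell M x z
  treeCell⇒cell (inj₁ refl) = diagonal _
  treeCell⇒cell (inj₂ (v , refl , refl)) = e-cell v

  -- The topmost cell of column `z` is itself a tree cell, and its two forms are the two
  -- alternatives.
  attained : ∀ z → μ z ≡ z ⊎ ∃ λ v → e v ≡ z × μ (inject₁ v) ≡ μ z
  attained z with cell⇒treeCell (μ z) z (μ-cell z)
  ... | inj₁ μz≡z = inj₁ μz≡z
  ... | inj₂ (v , μv≡μz , ev≡z) = inj₂ (v , ev≡z , μv≡μz)

increasing⇒encoded : {e : Fin m → Fin (suc m)} → Increasing e → ∃ λ M → Encodes M e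
increasing⇒encoded {m} {e} increasing = M , record
  { increasing = increasing
  ; lowest     = lowest-exists increasing
  ; cell⇔      = λ x z → mk⇔
      (λ cell → does⇒ (treeCell? x z) (trans (sym (entry x z)) cell))
      (λ treeCell → trans (entry x z) (dec-true (treeCell? x z) treeCell))
  }
  where
  μ = proj₁ (lowest-exists increasing)
  treeCell? : ∀ x z → Dec (TreeCell e μ x z)
  treeCell? x z = (x ≟ z) ⊎-dec any? λ v → (μ (inject₁ v) ≟ x) ×-dec (e v ≟ z)
  row : Fin (suc m) → Vec Bool (suc m)
  row x = tabulate λ j → does (treeCell? x (opposite j))
  M : Matrix (suc m)
  M = tabulate row
  entry : ∀ x z → lookup (lookup M x) (opposite z) ≡ does (treeCell? x z)
  entry x z = begin
    lookup (lookup M x) (opposite z)             ≡⟨ cong (λ bs → lookup bs (opposite z)) (lookup∘tabulate row x) ⟩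
    lookup (row x) (opposite z)                  ≡⟨ lookup∘tabulate (λ j → does (treeCell? x (opposite j))) (opposite z) ⟩
    does (treeCell? x (opposite (opposite z)))   ≡⟨ cong (does ∘ treeCell? x) (opposite-involutive z) ⟩
    does (treeCell? x z)                         ∎
    where open ≡-Reasoning
  does⇒ : {A : Set} (a? : Dec A) → does a? ≡ true → A
  does⇒ (yes a) _ = a

-- The two least-descendant maps belong to the same `e`, so `lowest-unique` identifies them and the
-- cells coincide.
encoded-unique : {M M′ : Matrix (suc m)} {e : Fin m → Fin (suc m)} →
                 Encodes M e → Encodes M′ e → M ≡ M′
encoded-unique {M = M} {M′} {e} encodes encodes′ = lookup-injective λ x → lookup-injective
  (opposite-elim (λ j → lookup (lookup M x) j ≡ lookup (lookup M′ x) j) λ z →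
    ⇔→≡ (mk⇔ (E′.cell⇔ x z .from ∘ subst-lowest μ≡μ′ ∘ E.cell⇔ x z .to)
              (E.cell⇔ x z .from ∘ subst-lowest (sym ∘ μ≡μ′) ∘ E′.cell⇔ x z .to)))
  where
  module E = Encodes encodes
  module E′ = Encodes encodes′
  μ≡μ′ : ∀ z → proj₁ E.lowest z ≡ proj₁ E′.lowest z
  μ≡μ′ = lowest-unique E.increasing (proj₂ E.lowest) (proj₂ E′.lowest)
  subst-lowest : ∀ {μ μ′ x z} → (∀ z → μ z ≡ μ′ z) → TreeCell e μ x z → TreeCell e μ′ x z
  subst-lowest same (inj₁ x≡z) = inj₁ x≡z
  subst-lowest same (inj₂ (v , μv≡x , ev≡z)) = inj₂ (v , trans (sym (same _)) μv≡x , ev≡z)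
  lookup-injective : {A : Set} {xs ys : Vec A n} → (∀ i → lookup xs i ≡ lookup ys i) → xs ≡ ys
  lookup-injective {xs = xs} {ys} same =
    trans (sym (tabulate∘lookup xs)) (trans (tabulate-cong same) (tabulate∘lookup ys))

encoding-unique : {M : Matrix (suc m)} {e e′ : Fin m → Fin (suc m)} →
                  Encodes M e → Encodes M e′ → ∀ v → e v ≡ e′ v
encoding-unique encodes encodes′ v = ≤-antisym
  (parents-≤ E.increasing (proj₂ E.lowest) E′.increasing (proj₂ E′.lowest)
    (λ x z → mk⇔ (E′.cell⇔ x z .to ∘ E.cell⇔ x z .from) (E.cell⇔ x z .to ∘ E′.cell⇔ x z .from)) v)
  (parents-≤ E′.increasing (proj₂ E′.lowest) E.increasing (proj₂ E.lowest)
    (λ x z → mk⇔ (E.cell⇔ x z .to ∘ E′.cell⇔ x z .from) (E′.cell⇔ x z .to ∘ E.cell⇔ x z .from)) v)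
  where
  module E = Encodes encodes
  module E′ = Encodes encodes′

-- Counting

-- One factor per node other than the root, sized by the number of nodes beyond it. The base `Fin 1`
-- matches `0 !`.
Code : ℕ → Set
Code zero    = Fin 1
Code (suc m) = Fin (suc m) × Code m

-- No node has `zero` as its parent, so deleting `zero` leaves a smaller tree of the same kind,
-- shifted by `suc`.
parent : Code m → Fin m → Fin (suc m)
parent {suc m} (x , κ) zero    = suc x
parent {suc m} (x , κ) (suc v) = suc (parent κ v)

parent-increasing : (κ : Code m) → Increasing (parent κ)
parent-increasing {suc m} (x , κ) zero    = s≤s z≤n
parent-increasing {suc m} (x , κ) (suc v) = s≤s (parent-increasing κ v)

parent-injective : (κ κ′ : Code m) → (∀ v → parent κ v ≡ parent κ′ v) → κ ≡ κ′
parent-injective {zero}  zero zero same = refl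
parent-injective {suc m} (x , κ) (x′ , κ′) same = cong₂ _,_ (suc-injective (same zero))
  (parent-injective κ κ′ (suc-injective ∘ same ∘ suc))

code-exists : (e : Fin m → Fin (suc m)) → Increasing e → ∃ λ κ → ∀ v → parent κ v ≡ e v
code-exists {zero}  e inc = zero , λ ()
code-exists {suc m} e inc = (proj₁ (suc-of zero) , proj₁ rest) , agree
  where
  -- A parent lies beyond some node, so it is never `zero`; matching on `inc v` discards that case.
  suc-of : ∀ v → ∃ λ x → suc x ≡ e v
  suc-of v with e v | inc v
  ... | suc x | _ = x , refl
  e′ : Fin m → Fin (suc m)
  e′ v = proj₁ (suc-of (suc v))
  rest : ∃ λ κ → ∀ v → parent κ v ≡ e′ v
  rest = code-exists e′ λ v → ℕ.s≤s⁻¹ (subst (suc (inject₁ v) <_) (sym (proj₂ (suc-of (suc v)))) (inc (suc v)))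
  agree : ∀ v → parent (proj₁ (suc-of zero) , proj₁ rest) v ≡ e v
  agree zero    = proj₂ (suc-of zero)
  agree (suc v) = trans (cong suc (proj₂ rest v)) (proj₂ (suc-of (suc v)))

code↔fin! : ∀ m → Code m ↔ Fin (m !)
code↔fin! zero    = ↔-refl
code↔fin! (suc m) = ↔-trans (↔-refl ×-↔ code↔fin! m) (↔-sym *↔×)

-- The Lehmer code: `remove` relabels the remaining values, so each entry is the rank of a value
-- among those not yet used.
permutationCode : Permutation′ m → Code m
permutationCode {zero}  π = zero
permutationCode {suc m} π = π ⟨$⟩ʳ zero , permutationCode (remove zero π)

remove-cong : (π ρ : Permutation′ (suc m)) → π Perm.≈ ρ → remove zero π Perm.≈ remove zero ρ
remove-cong π ρ π≈ρ i = punchIn-injective (π ⟨$⟩ʳ zero) _ _ (begin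
  punchIn (π ⟨$⟩ʳ zero) (remove zero π ⟨$⟩ʳ i)  ≡⟨ punchIn-permute π zero i ⟨
  π ⟨$⟩ʳ suc i                                 ≡⟨ π≈ρ (suc i) ⟩
  ρ ⟨$⟩ʳ suc i                                 ≡⟨ punchIn-permute ρ zero i ⟩
  punchIn (ρ ⟨$⟩ʳ zero) (remove zero ρ ⟨$⟩ʳ i)  ≡⟨ cong (λ k → punchIn k (remove zero ρ ⟨$⟩ʳ i)) (π≈ρ zero) ⟨
  punchIn (π ⟨$⟩ʳ zero) (remove zero ρ ⟨$⟩ʳ i)  ∎)
  where open ≡-Reasoning

permutationCode-cong : (π ρ : Permutation′ m) → π Perm.≈ ρ → permutationCode π ≡ permutationCode ρ
permutationCode-cong {zero}  π ρ π≈ρ = refl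
permutationCode-cong {suc m} π ρ π≈ρ =
  cong₂ _,_ (π≈ρ zero) (permutationCode-cong _ _ (remove-cong π ρ π≈ρ))

permutationCode-injective : (π ρ : Permutation′ m) → permutationCode π ≡ permutationCode ρ → π Perm.≈ ρ
permutationCode-injective {suc m} π ρ same zero = cong proj₁ same
permutationCode-injective {suc m} π ρ same (suc i) = begin
  π ⟨$⟩ʳ suc i                                 ≡⟨ punchIn-permute π zero i ⟩
  punchIn (π ⟨$⟩ʳ zero) (remove zero π ⟨$⟩ʳ i)  ≡⟨ cong₂ punchIn (cong proj₁ same)
                                                   (permutationCode-injective _ _ (cong proj₂ same) i) ⟩
  punchIn (ρ ⟨$⟩ʳ zero) (remove zero ρ ⟨$⟩ʳ i)  ≡⟨ punchIn-permute ρ zero i ⟨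
  ρ ⟨$⟩ʳ suc i                                 ∎
  where open ≡-Reasoning

-- `insert zero x` undoes one step of the code, though only up to `Perm.≈`, hence
-- `permutationCode-cong`.
permutationCode-surjective : (κ : Code m) → ∃ λ π → permutationCode π ≡ κ
permutationCode-surjective {zero}  zero = Perm.id , refl
permutationCode-surjective {suc m} (x , κ) with permutationCode-surjective κ
... | π , code≡κ = insert zero x π ,
  cong (x ,_) (trans (permutationCode-cong _ π (remove-insert zero x π)) code≡κ)

permutations↔codes : ∀ m → Inverse (Permutations m) (setoid (Code m))
permutations↔codes m = Bijection⇒Inverse record
  { to        = permutationCode
  ; cong      = λ {π} {ρ} → permutationCode-cong π ρ
  ; bijective = (λ {π} {ρ} → permutationCode-injective π ρ) , λ κ →
      let π , code≡κ = permutationCode-surjective κ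
      in π , λ {ρ} ρ≈π → trans (permutationCode-cong ρ π ρ≈π) code≡κ
  }

upperDiagonal↔codes : ∀ m → Inverse (UpperDiagonalCNM (suc m)) (setoid (Code m))
upperDiagonal↔codes m = Bijection⇒Inverse record
  { to        = proj₁ ∘ code
  ; cong      = λ {M} {M′} → code-cong M M′
  ; bijective = (λ {M} {M′} → code-injective M M′) , code-surjective
  }
  where
  UpperDiagonal = Setoid.Carrier (UpperDiagonalCNM (suc m))
  code : (M : UpperDiagonal) → ∃ λ κ → Encodes (proj₁ M) (parent κ)
  code (M , cnm , diag) =
    let e , encodes = triangular⇒encodes (upperDiagonal⇒triangular M cnm diag)
        κ , parent≡e = code-exists e (Encodes.increasing encodes)
    in κ , encodes-cong (sym ∘ parent≡e) encodes
  code-unique : ∀ M {κ κ′} → Encodes M (parent κ) → Encodes M (parent κ′) → κ ≡ κ′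
  code-unique M encodes encodes′ = parent-injective _ _ (encoding-unique encodes encodes′)
  -- The code is computed from the CNM proofs too; uniqueness of the encoding makes it depend on the
  -- matrix alone.
  code-cong : (M M′ : UpperDiagonal) → proj₁ M ≡ proj₁ M′ → proj₁ (code M) ≡ proj₁ (code M′)
  code-cong M M′ refl = code-unique (proj₁ M) (proj₂ (code M)) (proj₂ (code M′))
  code-injective : (M M′ : UpperDiagonal) → proj₁ (code M) ≡ proj₁ (code M′) → proj₁ M ≡ proj₁ M′
  code-injective M M′ same = encoded-unique
    (subst (λ κ → Encodes (proj₁ M) (parent κ)) same (proj₂ (code M))) (proj₂ (code M′))
  code-surjective : ∀ κ → ∃ λ M → ∀ {M′ : UpperDiagonal} → proj₁ M′ ≡ proj₁ M → proj₁ (code M′) ≡ κ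
  code-surjective κ =
    let M , encodes = increasing⇒encoded (parent-increasing κ)
        triangular = encodes⇒triangular encodes
    in (M , triangular⇒cnm triangular , triangular⇒upperDiagonal triangular) ,
       λ { {M′} refl → code-unique M (proj₂ (code M′)) encodes }

theorem4p3 : (n : ℕ) .{{_ : NonZero n}} →
    Inverse (UpperDiagonalCNM n) (Permutations (n ∸ 1)) ×
    Inverse (UpperDiagonalCNM n) (setoid (Fin ((n ∸ 1) !)))
theorem4p3 (suc m) =
  Compose.inverse (upperDiagonal↔codes m) (Symmetry.inverse (permutations↔codes m)) ,
  Compose.inverse (upperDiagonal↔codes m) (code↔fin! m)
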